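{- Let $\mathcal{KB}$ be a $\mathcal{DL}_{\mathbf D}^{4,\times}$-knowledge base, let $\phi_{\mathcal{KB}}$ be the set-theoretic formula representing it, and let $\mathcal{T}_{\mathcal{KB}}$ be the KE$^\gamma$-tableau computed by the procedure Consistency on input $\phi_{\mathcal{KB}}$. If $\mathcal{T}_{\mathcal{KB}}$ is not closed, then $\phi_{\mathcal{KB}}$ is satisfiable.
   Context: **Knowledge bases.** Let $\mathbf{D}$ be a data type map: a finite set $N_D$ of data types, for each $d\in N_D$ a set $N_C(d)$ of constants and a set $N_F(d)$ of facets, and interpretations $d^{\mathbf D}$ (nonempty and pairwise disjoint), $f^{\mathbf D}\subseteq d^{\mathbf D}$ for facets, $e_d^{\mathbf D}\in d^{\mathbf D}$ for constants. Given pairwise disjoint denumerable sets of abstract role names $S$ (among them the universal role $U$), concrete role names $T$, concept names $A$ and individual names $a,b$, the terms of the description logic $\mathcal{DL}_{\mathbf D}^{4,\times}$ are: data type terms $t::=dr\mid\neg t\mid t\sqcap t\mid t\sqcup t\mid\{e_d\}$ ($dr$ a data range for $\mathbf D$, $e_d\in N_C(d)$); concept terms $C::=A\mid\top\mid\bot\mid\neg C\mid C\sqcup C\mid C\sqcap C\mid\{a\}\mid\exists R.\mathit{Self}\mid\exists R.\{a\}\mid\exists P.\{e_d\}$; abstract role terms $R::=S\mid U\mid R^{ - }\mid\neg R\mid R\sqcup R\mid R\sqcap R\mid R_{C|}\mid R_{|C}\mid R_{C|C}\mid id(C)\mid C\times C$; concrete role terms $P::=T\mid\neg P\mid P\sqcup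 P\mid P\sqcap P\mid P_{C|}\mid P_{|t}\mid P_{C|t}$. A $\mathcal{DL}_{\mathbf D}^{4,\times}$-knowledge base $\mathcal{KB}$ consists of an RBox, a TBox and an ABox. RBox statements: $R_1\equiv R_2$, $R_1\sqsubseteq R_2$, $R_1\ldots R_n\sqsubseteq R_{n+1}$, $\mathsf{Sym}(R_1)$, $\mathsf{Asym}(R_1)$, $\mathsf{Ref}(R_1)$, $\mathsf{Irref}(R_1)$, $\mathsf{Dis}(R_1,R_2)$, $\mathsf{Tra}(R_1)$, $\mathsf{Fun}(R_1)$, $R_1\equiv C_1\times C_2$, $P_1\equiv P_2$, $P_1\sqsubseteq P_2$, $\mathsf{Dis}(P_1,P_2)$, $\mathsf{Fun}(P_1)$. TBox statements: $C_1\equiv C_2$, $C_1\sqsubseteq C_2$, $C_1\sqsubseteq\forall R_1.C_2$, $\exists R_1.C_1\sqsubseteq C_2$, $\geq_n R_1.C_1\sqsubseteq C_2$, $C_1\sqsubseteq{\leq_n R_1.C_2}$, $t_1\equiv t_2$, $t_1\sqsubseteq t_2$, $C_1\sqsubseteq\forall P_1.t_1$, $\exists P_1.t_1\sqsubseteq C_1$, $\geq_n P_1.t_1\sqsubseteq C_1$, $C_1\sqsubseteq{\leq_n P_1.t_1}$. ABox assertions: $a:C_1$, $(a,b):R_1$, $a=b$, $a\neq b$, $e_d:t_1$, $(a,e_d):P_1$. **Set-theoretic formulae.** There are variables of sort 0 ($x,y,z,\dots$), of sort 1 ($X^1,\dots$) and of sort 3 ($X^3,\dots$). Atomic formulae are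 $x=y$, $x\in X^1$, $\langle x,y\rangle\in X^3$; quantifier-free literals are atomic formulae and their negations. $\overline{A}$ is the complement of a literal $A$ (the negation of $A$ if $A$ is atomic, and $B$ if $A$ is $\neg B$). $\mathsf{Var}_0(\cdot)$ is the set of sort-0 variables occurring free, and $Q\mathsf{Var}_0(\psi)=\{x_1,\dots,x_m\}$ is the set of quantified variables of a purely universal formula $\psi=(\forall x_1)\ldots(\forall x_m)(\beta_1\vee\ldots\vee\beta_n)$, where $x_1,\dots,x_m$ have sort 0 and $\beta_1,\dots,\beta_n$ are quantifier-free literals. Bound variables are named apart from free ones. Substitutions replace free occurrences of variables by variables of the same sort; $\epsilon$ is the empty substitution; $\sigma\cdot\rho$ means first $\sigma$, then $\rho$. **The formula $\phi_{\mathcal{KB}}$.** It is the formula in conjunctive normal form $$\phi_{\mathcal{KB}}:=\bigwedge_{H\in\mathcal{KB}}\theta(H)\wedge\bigwedge_{i=1}^{12}\xi_i,$$ where $\theta$ is the fixed translation function taking each axiom or assertion $H$ of $\mathcal{KB}$ to a set-theoretic formula $\theta(H)$ (individuals and data constants being represented by variables of sort 0, concepts and data types by variables of sort 1, roles by variables of sort 3), and $\xi_1,\dots,\xi_{12}$ are fixed constraints ensuring that each model of $\phi_{\mathcal{KB}}$ can be transformed into an interpretation of the description logic, with disjoint nonempty domains of individuals and of data values. Every conjunct of $\phi_{\mathcal{KB}}$ is a quantifier-free literal or a purely universal formula of the form displayed above. **Interpretations.** An interpretation is a pair $\mathcal{M}=(D,M)$ with $D\ne\emptyset$ and $Mx\in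 D$, $MX^1\in\mathcal{P}(D)$, $MX^3\in\mathcal{P}(\mathcal{P}(\mathcal{P}(D)))$, where $\mathcal P$ is the powerset; pairs are interpreted as $M\langle x,y\rangle=\{\{Mx\},\{Mx,My\}\}$. Literals and propositional connectives are evaluated in the standard way, and $\mathcal{M}\models(\forall z_1)\ldots(\forall z_n)\varphi_0$ iff $\mathcal{M}[\vec z/\vec u]\models\varphi_0$ for all $\vec u\in D^n$. A formula $\varphi$ is satisfiable if $\mathcal{M}\models\varphi$ for some interpretation $\mathcal{M}$ (a model of $\varphi$). **KE$^\gamma$-tableaux.** Let $\Phi_{\mathcal{KB}}$ be the set of conjuncts of $\phi_{\mathcal{KB}}$. A KE$^\gamma$-tableau for $\Phi_{\mathcal{KB}}$ is a tree of formulae obtained from the one-branch tree listing the elements of $\Phi_{\mathcal{KB}}$ by finitely many steps, each of which applies one of the following rules to a branch $\vartheta$, or replaces a branch $\vartheta$ by $\vartheta\sigma$ (a substitution $\sigma$ applied to every formula of $\vartheta$): - E$^\gamma$-rule: if $\psi=(\forall x_1)\ldots(\forall x_m)(\beta_1\vee\ldots\vee\beta_n)$ is in $\vartheta$, $\tau=\{x_1/x_{o_1},\ldots,x_m/x_{o_m}\}$ with $x_{o_1},\dots,x_{o_m}\in\mathsf{Var}_0(\phi_{\mathcal{KB}})$, and all elements of $\mathcal{S}^{\overline\beta\tau}_i:=\{\overline\beta_1\tau,\dots,\overline\beta_n\tau\}\setminus\{\overline\beta_i\tau\}$ are in $\vartheta$, then append $\beta_i\tau$ to $\vartheta$. - PB-rule: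 for a literal $A$, split $\vartheta$ into two branches, appending $A$ to one and $\overline A$ to the other. A branch is closed if it contains both $A$ and $\neg A$ for some formula $A$, or a literal $\neg(x=x)$; otherwise it is open. A tableau is closed if all its branches are closed. A purely universal formula $\psi=(\forall x_1)\ldots(\forall x_m)(\beta_1\vee\ldots\vee\beta_n)$ is fulfilled in $\vartheta$ if for every $\tau:Q\mathsf{Var}_0(\psi)\to\mathsf{Var}_0(\phi_{\mathcal{KB}})$ the branch contains $\beta_i\tau$ for some $i$. A branch is fulfilled if every purely universal formula in it is fulfilled in it. A tableau is fulfilled if each of its branches is fulfilled or closed. **Procedure Consistency($\phi_{\mathcal{KB}}$)** (choices are arbitrary). (1) Start with the one-branch tableau $\mathcal{T}_{\mathcal{KB}}:=\Phi_{\mathcal{KB}}$ and $\mathcal{E}:=\emptyset$. (2) While $\mathcal{T}_{\mathcal{KB}}$ is not fulfilled: select a not fulfilled open branch $\vartheta$ and a formula $\psi=(\forall x_1)\ldots(\forall x_m)(\beta_1\vee\ldots\vee\beta_n)$ in $\vartheta$ not fulfilled in $\vartheta$; for each substitution $\tau$ of $x_1,\dots,x_m$ by elements of $\mathsf{Var}_0(\phi_{\mathcal{KB}})$: if $\beta_i\tau\notin\vartheta$ for every $i$, then (2a) if $\mathcal{S}^{\overline\beta\tau}_j$ is contained in $\vartheta$ for some $j$, apply the E$^\gamma$-rule to $\psi$ and $\mathcal{S}^{\overline\beta\tau}_j$ on $\vartheta$; (2b) otherwise, let $h$ be the least index with $\overline\beta_h\tau\notin\vartheta$ and apply the PB-rule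 with $A=\overline\beta_h\tau$ on $\vartheta$ (either resulting branch may then play the role of $\vartheta$). (3) For each branch $\vartheta$ of $\mathcal{T}_{\mathcal{KB}}$ that is open: set $\sigma_\vartheta:=\epsilon$ and $\mathsf{Eq}_\vartheta:=\{$literals of type $x=y$ occurring in $\vartheta\}$; while $\mathsf{Eq}_\vartheta$ contains some $x=y$ with $x,y$ distinct, select such a literal, let $z$ be the minimum of $x,y$ in a fixed total order on $\mathsf{Var}_0(\phi_{\mathcal{KB}})$, and set $\sigma_\vartheta:=\sigma_\vartheta\cdot\{x/z,y/z\}$ and then $\mathsf{Eq}_\vartheta:=\mathsf{Eq}_\vartheta\sigma_\vartheta$; finally add $(\vartheta,\sigma_\vartheta)$ to $\mathcal{E}$ and replace $\vartheta$ by $\vartheta\sigma_\vartheta$. (4) Return $(\mathcal{T}_{\mathcal{KB}},\mathcal{E})$. -}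

module Defs where

open import Level using (Level; _⊔_; Lift; 0ℓ) renaming (suc to lsuc)
open import Data.Bool using (if_then_else_; _∨_)
open import Data.Nat using (ℕ; suc; _≟_)
open import Data.Fin using (Fin; _<_)
open import Data.List using (List; []; _∷_; _++_; map; concatMap; allFin; [_])
open import Data.List.NonEmpty using (List⁺)
open import Data.List.Membership.Propositional using (_∈_; _∉_)
open import Data.List.Relation.Unary.All using (All)
open import Data.List.Relation.Unary.Unique.Propositional using (Unique)
open import Data.Product using (Σ; ∃; ∃₂; _×_; _,_)
open import Data.Sum using (_⊎_; inj₁; inj₂; [_,_]′)
open import Data.Vec as Vec using (Vec; lookup)
import Data.Vec.Relation.Unary.All as VecAll
open import Function using (id; _∘_)
open import Function.Bundles using (_↔_; _⇔_)
open import Relation.Binary using (Rel; Setoid; _Respects_)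
open import Relation.Binary.Construct.Closure.ReflexiveTransitive using (Star)
open import Relation.Binary.PropositionalEquality using (_≡_; _≢_; setoid)
open import Relation.Nullary using (¬_; does)
open import Relation.Unary using (Pred; _⊆_; _⊥_; _≐_)
import Relation.Unary as Unary
import Relation.Unary.Properties as Unary

record DataTypeMap : Set₁ where
  field
    N-D       : Set
    finite    : ∃ λ n → N-D ↔ Fin n
    N-C       : N-D → Set
    N-F       : N-D → Set
    Value     : Set
    ⟦_⟧       : N-D → Pred Value 0ℓ
    ⟦_⟧ᶠ      : ∀ {d} → N-F d → Pred Value 0ℓ
    ⟦_⟧ᶜ      : ∀ {d} → N-C d → Value
    nonempty  : ∀ d → Unary.Satisfiable ⟦ d ⟧
    disjoint  : ∀ {d d′} → d ≢ d′ → ⟦ d ⟧ ⊥ ⟦ d′ ⟧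
    facet-⊆   : ∀ {d} (f : N-F d) → ⟦ f ⟧ᶠ ⊆ ⟦ d ⟧
    constant∈ : ∀ {d} (e : N-C d) → Unary._∈_ ⟦ e ⟧ᶜ ⟦ d ⟧

  Constant : Set
  Constant = Σ N-D N-C

-- The four denumerable sets of names; they are kept disjoint by the
-- constructors below.  The universal role is the constructor U.
ConceptName AbstractRoleName ConcreteRoleName Individual : Set
ConceptName      = ℕ
AbstractRoleName = ℕ
ConcreteRoleName = ℕ
Individual       = ℕ

module _ (𝐃 : DataTypeMap) where
  open DataTypeMap 𝐃

  data FacetExpression (d : N-D) : Set where
    facet         : N-F d → FacetExpression d
    ⊤ᶠ ⊥ᶠ         : FacetExpression d
    ¬ᶠ_           : FacetExpression d → FacetExpression d
    _∧ᶠ_ _∨ᶠ_     : FacetExpression d → FacetExpression d → FacetExpression d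

  -- As usual for the data ranges of a data type map: data types, finite
  -- enumerations of constants, facet expressions, and complements of these.
  data DataRange : Set where
    dataType    : N-D → DataRange
    enumeration : List⁺ Constant → DataRange
    restriction : ∀ {d} → FacetExpression d → DataRange
    complement  : DataRange → DataRange

  infixl 7 _⊓_ _⊓ᵈ_ _⊓ʳ_ _⊓ᶜ_
  infixl 6 _⊔ᵗ_ _⊔ᵈ_ _⊔ʳ_ _⊔ᶜ_

  data DataTerm : Set where
    range     : DataRange → DataTerm
    ¬ᵈ_       : DataTerm → DataTerm
    _⊓ᵈ_ _⊔ᵈ_ : DataTerm → DataTerm → DataTerm
    ｛_｝ᵈ    : Constant → DataTerm

  data Concept      : Set
  data AbstractRole : Set
  data ConcreteRole : Set

  data Concept where
    name          : ConceptName → Concept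
    ⊤ᵗ ⊥ᵗ         : Concept
    ¬ᵗ_           : Concept → Concept
    _⊔ᵗ_ _⊓_      : Concept → Concept → Concept
    ｛_｝         : Individual → Concept
    ∃_·Self       : AbstractRole → Concept
    ∃_·｛_｝      : AbstractRole → Individual → Concept
    ∃ᶜ_·｛_｝     : ConcreteRole → Constant → Concept

  data AbstractRole where
    name          : AbstractRoleName → AbstractRole
    U             : AbstractRole
    _⁻            : AbstractRole → AbstractRole
    ¬ʳ_           : AbstractRole → AbstractRole
    _⊔ʳ_ _⊓ʳ_     : AbstractRole → AbstractRole → AbstractRole
    restrictˡ     : AbstractRole → Concept → AbstractRole
    restrictʳ     : AbstractRole → Concept → AbstractRole
    restrict      : AbstractRole → Concept → Concept → AbstractRole
    idʳ           : Concept → AbstractRole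
    _×ʳ_          : Concept → Concept → AbstractRole

  data ConcreteRole where
    name          : ConcreteRoleName → ConcreteRole
    ¬ᶜ_           : ConcreteRole → ConcreteRole
    _⊔ᶜ_ _⊓ᶜ_     : ConcreteRole → ConcreteRole → ConcreteRole
    restrictˡ     : ConcreteRole → Concept → ConcreteRole
    restrictʳ     : ConcreteRole → DataTerm → ConcreteRole
    restrict      : ConcreteRole → Concept → DataTerm → ConcreteRole

  data RBoxStatement : Set where
    _≡ʳ_ _⊑ʳ_                      : AbstractRole → AbstractRole → RBoxStatement
    chain_⊑_                       : List⁺ AbstractRole → AbstractRole → RBoxStatement
    Sym Asym Ref Irref Tra Fun     : AbstractRole → RBoxStatement
    Dis                            : AbstractRole → AbstractRole → RBoxStatement
    _≡_×ᶜ_                         : AbstractRole → Concept → Concept → RBoxStatement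
    _≡ᶜ_ _⊑ᶜ_                      : ConcreteRole → ConcreteRole → RBoxStatement
    Disᶜ                           : ConcreteRole → ConcreteRole → RBoxStatement
    Funᶜ                           : ConcreteRole → RBoxStatement

  data TBoxStatement : Set where
    _≡ᵗ_ _⊑ᵗ_    : Concept → Concept → TBoxStatement
    _⊑∀_·_       : Concept → AbstractRole → Concept → TBoxStatement
    ∃_·_⊑_       : AbstractRole → Concept → Concept → TBoxStatement
    ≥_[_·_]⊑_    : ℕ → AbstractRole → Concept → Concept → TBoxStatement
    _⊑≤_[_·_]    : Concept → ℕ → AbstractRole → Concept → TBoxStatement
    _≡ᵈ_ _⊑ᵈ_    : DataTerm → DataTerm → TBoxStatement
    _⊑∀ᶜ_·_      : Concept → ConcreteRole → DataTerm → TBoxStatement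
    ∃ᶜ_·_⊑_      : ConcreteRole → DataTerm → Concept → TBoxStatement
    ≥ᶜ_[_·_]⊑_   : ℕ → ConcreteRole → DataTerm → Concept → TBoxStatement
    _⊑≤ᶜ_[_·_]   : Concept → ℕ → ConcreteRole → DataTerm → TBoxStatement

  data ABoxStatement : Set where
    _∶_          : Individual → Concept → ABoxStatement
    ⟨_,_⟩∶_      : Individual → Individual → AbstractRole → ABoxStatement
    _≈ⁱ_ _≉ⁱ_    : Individual → Individual → ABoxStatement
    _∶ᵈ_         : Constant → DataTerm → ABoxStatement
    ⟨_,_⟩∶ᶜ_     : Individual → Constant → ConcreteRole → ABoxStatement

  data Statement : Set where
    rbox : RBoxStatement → Statement
    tbox : TBoxStatement → Statement
    abox : ABoxStatement → Statement

  record KnowledgeBase : Set where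
    field
      RBox : List RBoxStatement
      TBox : List TBoxStatement
      ABox : List ABoxStatement

    statements : List Statement
    statements = map rbox RBox ++ map tbox TBox ++ map abox ABox

Var₀ Var₁ Var₃ : Set
Var₀ = ℕ
Var₁ = ℕ
Var₃ = ℕ

data Atom (V : Set) : Set where
  _≈_     : V → V → Atom V
  _∈¹_    : V → Var₁ → Atom V
  ⟨_,_⟩∈³_ : V → V → Var₃ → Atom V

data Literal (V : Set) : Set where
  pos neg : Atom V → Literal V

mapAtom : ∀ {V W : Set} → (V → W) → Atom V → Atom W
mapAtom f (x ≈ y)         = f x ≈ f y
mapAtom f (x ∈¹ X)        = f x ∈¹ X
mapAtom f (⟨ x , y ⟩∈³ X) = ⟨ f x , f y ⟩∈³ X

mapLiteral : ∀ {V W : Set} → (V → W) → Literal V → Literal W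
mapLiteral f (pos A) = pos (mapAtom f A)
mapLiteral f (neg A) = neg (mapAtom f A)

atomVars : ∀ {V : Set} → Atom V → List V
atomVars (x ≈ y)         = x ∷ y ∷ []
atomVars (x ∈¹ X)        = x ∷ []
atomVars (⟨ x , y ⟩∈³ X) = x ∷ y ∷ []

literalVars : ∀ {V : Set} → Literal V → List V
literalVars (pos A) = atomVars A
literalVars (neg A) = atomVars A

_ᶜ : ∀ {V : Set} → Literal V → Literal V
pos A ᶜ = neg A
neg A ᶜ = pos A

-- (∀ x₁) … (∀ xₘ) (β₁ ∨ … ∨ βₙ) with m = suc m′ and n = suc n′.  The
-- variables of the disjuncts are inj₁ i, bound by the i-th quantifier, or
-- inj₂ x, free; so bound variables are named apart from free ones.
record Universal : Set where
  constructor ∀∨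
  field
    {m′ n′} : ℕ
    β       : Vec (Literal (Fin (suc m′) ⊎ Var₀)) (suc n′)

  m n : ℕ
  m = suc m′
  n = suc n′

data Formula : Set where
  lit  : Literal Var₀ → Formula
  univ : Universal → Formula

-- A formula in conjunctive normal form, as the list of its conjuncts.
CNF : Set
CNF = List Formula

freeVars : Formula → List Var₀
freeVars (lit L)  = literalVars L
freeVars (univ ψ) = concatMap free (Vec.toList (Universal.β ψ))
  where
  free : Literal (Fin (Universal.m ψ) ⊎ Var₀) → List Var₀
  free = concatMap [ (λ _ → []) , [_] ]′ ∘ literalVars

Vars₀ : CNF → List Var₀
Vars₀ = concatMap freeVars

-- Only variables of sort 0 are ever replaced.
Subst : Set
Subst = Var₀ → Var₀

ε : Subst
ε = id

_·_ : Subst → Subst → Subst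
σ · ρ = ρ ∘ σ

_⟪_⟫ : Formula → Subst → Formula
lit L      ⟪ σ ⟫ = lit (mapLiteral σ L)
univ (∀∨ β) ⟪ σ ⟫ = univ (∀∨ (Vec.map (mapLiteral [ inj₁ , inj₂ ∘ σ ]′) β))

-- βᵢτ, for τ replacing the quantified variables of ψ by free ones.
inst : (ψ : Universal) → Fin (Universal.n ψ) → Vec Var₀ (Universal.m ψ) → Literal Var₀
inst ψ i τ = mapLiteral [ lookup τ , id ]′ (lookup (Universal.β ψ) i)

-- Predicates have to respect equality, since sets of sets
-- are compared extensionally.
record 𝒫 {a ℓ} (S : Setoid a ℓ) : Set (a ⊔ lsuc ℓ) where
  open Setoid S using (Carrier) renaming (_≈_ to _≈ₛ_)
  field
    member : Pred Carrier ℓ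
    resp   : member Respects _≈ₛ_

open 𝒫

𝒫-setoid : ∀ {a ℓ} → Setoid a ℓ → Setoid (a ⊔ lsuc ℓ) (a ⊔ ℓ)
𝒫-setoid S = record
  { Carrier       = 𝒫 S
  ; _≈_           = λ A B → member A ≐ member B
  ; isEquivalence = record
    { refl = Unary.≐-refl ; sym = Unary.≐-sym ; trans = Unary.≐-trans } }

｛_,_｝ : ∀ {a ℓ} {S : Setoid a ℓ} → Setoid.Carrier S → Setoid.Carrier S → 𝒫 S
｛_,_｝ {S = S} x y = record
  { member = λ z → (z ≈ₛ x) ⊎ (z ≈ₛ y)
  ; resp   = λ z≈w → [ (λ z≈x → inj₁ (S.trans (S.sym z≈w) z≈x))
                     , (λ z≈y → inj₂ (S.trans (S.sym z≈w) z≈y)) ]′ }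
  where
  module S = Setoid S
  open S using () renaming (_≈_ to _≈ₛ_)

module _ (D : Set) where
  𝒫¹ 𝒫² 𝒫³ : Setoid _ _
  𝒫¹ = 𝒫-setoid (setoid D)
  𝒫² = 𝒫-setoid 𝒫¹
  𝒫³ = 𝒫-setoid 𝒫²

-- {{u}, {u, v}}
pair : ∀ {D : Set} → D → D → 𝒫 (𝒫¹ D)
pair {D} u v = ｛_,_｝ {S = 𝒫¹ D} (｛_,_｝ {S = setoid D} u u) (｛_,_｝ {S = setoid D} u v)

record Interpretation : Set₂ where
  field
    D        : Set
    nonempty : D
    M₀       : Var₀ → D
    M₁       : Var₁ → 𝒫 (setoid D)
    M₃       : Var₃ → 𝒫 (𝒫² D)

module _ (ℳ : Interpretation) where
  open Interpretation ℳ

  ⟦_⟧ᵃ : ∀ {V : Set} → Atom V → (V → D) → Set₁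
  ⟦ x ≈ y ⟧ᵃ         η = Lift _ (η x ≡ η y)
  ⟦ x ∈¹ X ⟧ᵃ        η = Lift _ (member (M₁ X) (η x))
  ⟦ ⟨ x , y ⟩∈³ X ⟧ᵃ η = member (M₃ X) (pair (η x) (η y))

  ⟦_⟧ˡ : ∀ {V : Set} → Literal V → (V → D) → Set₁
  ⟦ pos A ⟧ˡ η = ⟦ A ⟧ᵃ η
  ⟦ neg A ⟧ˡ η = ¬ ⟦ A ⟧ᵃ η

  ⊨_ : Formula → Set₁
  ⊨ lit L  = ⟦ L ⟧ˡ M₀
  ⊨ univ ψ = (u : Vec D m) → ∃ λ i → ⟦ lookup β i ⟧ˡ [ lookup u , M₀ ]′
    where open Universal ψ

_⊨_ : Interpretation → CNF → Set₁
ℳ ⊨ φ = All (⊨_ ℳ) φ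

Satisfiable : CNF → Set₂
Satisfiable φ = ∃ λ ℳ → ℳ ⊨ φ

record Translation (𝐃 : DataTypeMap) : Set₂ where
  field
    θ : Statement 𝐃 → CNF
    ξ : KnowledgeBase 𝐃 → Fin 12 → CNF

  constraints : KnowledgeBase 𝐃 → CNF
  constraints 𝒦ℬ = concatMap (ξ 𝒦ℬ) (allFin 12)

  field
    -- The variables for the domains of individuals and of data values.
    X-I X-D : Var₁

    domains-nonempty : ∀ 𝒦ℬ ℳ → ℳ ⊨ constraints 𝒦ℬ → let open Interpretation ℳ in
      Unary.Satisfiable (member (M₁ X-I)) × Unary.Satisfiable (member (M₁ X-D))
    domains-disjoint : ∀ 𝒦ℬ ℳ → ℳ ⊨ constraints 𝒦ℬ → let open Interpretation ℳ in
      member (M₁ X-I) ⊥ member (M₁ X-D)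

    -- Satisfiable purely universal formulae without free variables of sort 0
    -- have one-element models, in which the two domains cannot be disjoint
    -- and nonempty.  The constraints therefore name elements of the domains.
    -- (For unsatisfiable constraints this would not follow from the above.)
    domains-named : ∀ 𝒦ℬ → ∃ λ x → x ∈ Vars₀ (constraints 𝒦ℬ)

  φ : KnowledgeBase 𝐃 → CNF
  φ 𝒦ℬ = concatMap θ (KnowledgeBase.statements 𝒦ℬ) ++ constraints 𝒦ℬ

-- A branch is the set of formulae on it, and a tableau is given by its branches.
Branch Tableau : Set
Branch  = List Formula
Tableau = List Branch

data ClosedBranch (ϑ : Branch) : Set where
  clash       : ∀ {A} → lit (pos A) ∈ ϑ → lit (neg A) ∈ ϑ → ClosedBranch ϑ
  irreflexive : ∀ {x} → lit (neg (x ≈ x)) ∈ ϑ → ClosedBranch ϑ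

OpenBranch : Branch → Set
OpenBranch ϑ = ¬ ClosedBranch ϑ

Closed : Tableau → Set
Closed 𝒯 = All ClosedBranch 𝒯

-- The set {β̄₁τ, …, β̄ₙτ} ∖ {β̄ᵢτ} is contained in ϑ.
S⊆ : (ψ : Universal) → Fin (Universal.n ψ) → Vec Var₀ (Universal.m ψ) → Branch → Set
S⊆ ψ i τ ϑ = ∀ j → inst ψ j τ ᶜ ≢ inst ψ i τ ᶜ → lit (inst ψ j τ ᶜ) ∈ ϑ

module _ (φ : CNF) where

  Instantiation : Universal → Set
  Instantiation ψ = Vec Var₀ (Universal.m ψ)

  OverVars₀ : ∀ {ψ} → Instantiation ψ → Set
  OverVars₀ τ = VecAll.All (_∈ Vars₀ φ) τ

  data Eγ-rule (ψ : Universal) (τ : Instantiation ψ) (i : Fin (Universal.n ψ))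
               (ϑ : Branch) : Branch → Set where
    eγ : univ ψ ∈ ϑ → OverVars₀ {ψ} τ → S⊆ ψ i τ ϑ →
         Eγ-rule ψ τ i ϑ (lit (inst ψ i τ) ∷ ϑ)

  data PB-rule (A : Literal Var₀) (ϑ : Branch) : Branch → Branch → Set where
    pb : PB-rule A ϑ (lit A ∷ ϑ) (lit (A ᶜ) ∷ ϑ)

  Fulfilled : Universal → Branch → Set
  Fulfilled ψ ϑ = ∀ τ → OverVars₀ {ψ} τ → ∃ λ i → lit (inst ψ i τ) ∈ ϑ

  FulfilledBranch : Branch → Set
  FulfilledBranch ϑ = ∀ ψ → univ ψ ∈ ϑ → Fulfilled ψ ϑ

  FulfilledTableau : Tableau → Set
  FulfilledTableau 𝒯 = All (λ ϑ → FulfilledBranch ϑ ⊎ ClosedBranch ϑ) 𝒯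

  -- The body of the for-loop for τ: the branch becomes ϑ′, and the
  -- branches in the list are split off.
  data Process (ψ : Universal) (τ : Instantiation ψ) (ϑ : Branch) :
               (ϑ′ : Branch) → List Branch → Set where
    keep     : ∀ {i} → lit (inst ψ i τ) ∈ ϑ → Process ψ τ ϑ ϑ []
    apply-Eγ : ∀ {j ϑ′} → (∀ i → lit (inst ψ i τ) ∉ ϑ) →
               S⊆ ψ j τ ϑ → Eγ-rule ψ τ j ϑ ϑ′ →
               Process ψ τ ϑ ϑ′ []
    apply-PB : ∀ {h ϑ₁ ϑ₂ ϑ′ ϑ″} → (∀ i → lit (inst ψ i τ) ∉ ϑ) →
               (∀ j → ¬ S⊆ ψ j τ ϑ) →
               lit (inst ψ h τ ᶜ) ∉ ϑ →
               (∀ k → k < h → lit (inst ψ k τ ᶜ) ∈ ϑ) →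
               PB-rule (inst ψ h τ ᶜ) ϑ ϑ₁ ϑ₂ →
               (ϑ′ ≡ ϑ₁ × ϑ″ ≡ ϑ₂) ⊎ (ϑ′ ≡ ϑ₂ × ϑ″ ≡ ϑ₁) →
               Process ψ τ ϑ ϑ′ [ ϑ″ ]

  data ForEach (ψ : Universal) : List (Instantiation ψ) → Branch →
               Branch → List Branch → Set where
    []  : ∀ {ϑ} → ForEach ψ [] ϑ ϑ []
    _∷_ : ∀ {τ τs ϑ ϑ′ ϑ″ new new′} → Process ψ τ ϑ ϑ′ new →
          ForEach ψ τs ϑ′ ϑ″ new′ → ForEach ψ (τ ∷ τs) ϑ ϑ″ (new ++ new′)

  -- One iteration of the expansion loop; τs lists all the instantiations of ψ,
  -- in an arbitrary order.
  data Expand : Rel Tableau 0ℓ where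
    expand : ∀ {𝒯₁ ϑ 𝒯₂ ψ τs ϑ′ new} →
             ¬ FulfilledBranch ϑ → OpenBranch ϑ →
             univ ψ ∈ ϑ → ¬ Fulfilled ψ ϑ →
             Unique τs → (∀ τ → τ ∈ τs ⇔ OverVars₀ {ψ} τ) →
             ForEach ψ τs ϑ ϑ′ new →
             Expand (𝒯₁ ++ ϑ ∷ 𝒯₂) (𝒯₁ ++ ϑ′ ∷ new ++ 𝒯₂)

equations : Branch → List (Var₀ × Var₀)
equations = concatMap equation
  where
  equation : Formula → List (Var₀ × Var₀)
  equation (lit (pos (x ≈ y))) = [ x , y ]
  equation _                   = []

-- {x/z, y/z}
_⨾_↦_ : Var₀ → Var₀ → Var₀ → Subst
(x ⨾ y ↦ z) w = if does (w ≟ x) ∨ does (w ≟ y) then z else w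

module _ (_≼_ : Rel Var₀ 0ℓ) where

  IsMin : Var₀ → Var₀ → Var₀ → Set
  IsMin z x y = (z ≡ x × x ≼ y) ⊎ (z ≡ y × y ≼ x)

  -- Unify σ Eq σ′: the loop entered with σ_ϑ = σ and Eq_ϑ = Eq may end with
  -- σ_ϑ = σ′.
  data Unify : Subst → List (Var₀ × Var₀) → Subst → Set where
    done : ∀ {σ Eq} → (∀ {x y} → (x , y) ∈ Eq → x ≡ y) → Unify σ Eq σ
    step : ∀ {σ Eq σ′ x y z} → (x , y) ∈ Eq → x ≢ y → IsMin z x y →
           let σ₁ = σ · (x ⨾ y ↦ z) in
           Unify σ₁ (map (λ (v , w) → σ₁ v , σ₁ w) Eq) σ′ →
           Unify σ Eq σ′

  data UnifyBranches : Tableau → Tableau → List (Branch × Subst) → Set where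
    []     : UnifyBranches [] [] []
    closed : ∀ {ϑ 𝒯 𝒯′ ℰ} → ClosedBranch ϑ → UnifyBranches 𝒯 𝒯′ ℰ →
             UnifyBranches (ϑ ∷ 𝒯) (ϑ ∷ 𝒯′) ℰ
    open′  : ∀ {ϑ σ 𝒯 𝒯′ ℰ} → OpenBranch ϑ → Unify ε (equations ϑ) σ →
             UnifyBranches 𝒯 𝒯′ ℰ →
             UnifyBranches (ϑ ∷ 𝒯) (map (_⟪ σ ⟫) ϑ ∷ 𝒯′) ((ϑ , σ) ∷ ℰ)

  -- Consistency φ 𝒯 ℰ: some run of the nondeterministic procedure on φ
  -- returns (𝒯 , ℰ).
  record Consistency (φ : CNF) (𝒯 : Tableau) (ℰ : List (Branch × Subst)) : Set where
    field
      𝒯₂        : Tableau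
      expansion : Star (Expand φ) [ φ ] 𝒯₂
      fulfilled : FulfilledTableau φ 𝒯₂
      unify     : UnifyBranches 𝒯₂ 𝒯 ℰ

{-# OPTIONS --safe #-}

-- A branch that is still open after unification is a Herbrand-style model of φ:
-- its domain consists of the representatives σ x of the variables x of φ, and
-- the sets are read off the positive literals on the unified branch ϑσ.
-- Fulfilledness of ϑ settles the universal formulae, since each element of the
-- domain is σ x for some x in Var₀(φ); the equations of ϑ hold since σ unifies them.

module Submission where

open import Defs
open import Level using (0ℓ; lift)
open import Data.Bool using (true; false)
open import Data.Bool.Properties using (T-irrelevant)
open import Data.Empty using (⊥-elim)
open import Data.Fin using (Fin; zero; suc)
open import Data.List using (List; []; _∷_; _++_; map; concatMap)
open import Data.List.Membership.DecPropositional using () renaming (_∈?_ to member?)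
open import Data.List.Membership.Propositional using (_∈_; find; lose)
open import Data.List.Membership.Propositional.Properties
  using (∈-map⁺; ∈-map⁻; ∈-++⁺ʳ; ∈-concatMap⁺; ∈-concatMap⁻)
open import Data.List.Relation.Binary.Subset.Propositional using (_⊆_)
open import Data.List.Relation.Binary.Subset.Propositional.Properties
  using (⊆-refl; ⊆-trans)
open import Data.List.Relation.Unary.All as All using (All; []; _∷_)
import Data.List.Relation.Unary.All.Properties as All
open import Data.List.Relation.Unary.Any using (Any; here; there; any?)
open import Data.Nat using (ℕ; _≟_; _≡ᵇ_)
open import Data.Nat.Properties using (≡ᵇ⇒≡)
open import Data.Product using (Σ; ∃; ∃₂; _×_; _,_; proj₁; proj₂)
open import Data.Sum using (_⊎_; inj₁; inj₂; [_,_]′; reduce)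
open import Data.Unit using (tt)
open import Data.Vec as Vec using (Vec; lookup)
open import Data.Vec.Membership.Propositional.Properties using (∈-lookup; ∈-toList⁺)
import Data.Vec.Relation.Unary.All as VecAll
open import Function using (id; _∘_)
open import Relation.Binary using (Rel; IsTotalOrder; Setoid; DecidableEquality)
open import Relation.Binary.Construct.Closure.ReflexiveTransitive using (Star; ε; _◅_)
open import Relation.Binary.PropositionalEquality
  using (_≡_; refl; sym; trans; cong; subst; setoid)
open import Relation.Nullary using (¬_; Dec; yes; no; contradiction)
open import Relation.Nullary.Decidable using (True; toWitness; fromWitness; map′; _×-dec_)
import Relation.Unary.Properties as Unary

-- Decidability of branch closure

_≟ᵃ_ : DecidableEquality (Atom ℕ)
(x ≈ y)         ≟ᵃ (x′ ≈ y′)          =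
  map′ (λ { (refl , refl) → refl }) (λ { refl → refl , refl }) ((x ≟ x′) ×-dec (y ≟ y′))
(x ≈ y)         ≟ᵃ (_ ∈¹ _)           = no λ ()
(x ≈ y)         ≟ᵃ (⟨ _ , _ ⟩∈³ _)    = no λ ()
(x ∈¹ X)        ≟ᵃ (_ ≈ _)            = no λ ()
(x ∈¹ X)        ≟ᵃ (x′ ∈¹ X′)         =
  map′ (λ { (refl , refl) → refl }) (λ { refl → refl , refl }) ((x ≟ x′) ×-dec (X ≟ X′))
(x ∈¹ X)        ≟ᵃ (⟨ _ , _ ⟩∈³ _)    = no λ ()
(⟨ x , y ⟩∈³ X) ≟ᵃ (_ ≈ _)            = no λ ()
(⟨ x , y ⟩∈³ X) ≟ᵃ (_ ∈¹ _)           = no λ ()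
(⟨ x , y ⟩∈³ X) ≟ᵃ (⟨ x′ , y′ ⟩∈³ X′) =
  map′ (λ { (refl , refl , refl) → refl }) (λ { refl → refl , refl , refl })
       ((x ≟ x′) ×-dec ((y ≟ y′) ×-dec (X ≟ X′)))

posLit? : ∀ A (ϑ : Branch) → Dec (lit (pos A) ∈ ϑ)
posLit? A = any? λ where
  (lit (pos B)) → map′ (cong (lit ∘ pos)) (λ { refl → refl }) (A ≟ᵃ B)
  (lit (neg _)) → no λ ()
  (univ _)      → no λ ()

data Clashes (ϑ : Branch) : Formula → Set where
  clash       : ∀ {A} → lit (pos A) ∈ ϑ → Clashes ϑ (lit (neg A))
  irreflexive : ∀ {x} → Clashes ϑ (lit (neg (x ≈ x)))

clashes? : ∀ ϑ F → Dec (Clashes ϑ F)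
clashes? ϑ (lit (pos _)) = no λ ()
clashes? ϑ (univ _)      = no λ ()
clashes? ϑ (lit (neg A)) with posLit? A ϑ
clashes? ϑ (lit (neg A))                | yes p = yes (clash p)
clashes? ϑ (lit (neg (x ≈ y)))          | no ¬p with x ≟ y
... | yes refl = yes irreflexive
... | no x≢y   = no λ { (clash p) → ¬p p ; irreflexive → x≢y refl }
clashes? ϑ (lit (neg (x ∈¹ X)))         | no ¬p = no λ { (clash p) → ¬p p }
clashes? ϑ (lit (neg (⟨ x , y ⟩∈³ X)))  | no ¬p = no λ { (clash p) → ¬p p }

-- Constructively, `¬ Closed` exhibits no open branch; deciding closure branch by branch finds one.
closedBranch? : ∀ ϑ → Dec (ClosedBranch ϑ)
closedBranch? ϑ = map′ from to (any? (clashes? ϑ) ϑ)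
  where
  from : Any (Clashes ϑ) ϑ → ClosedBranch ϑ
  from any with find any
  ... | _ , ¬A∈ϑ , clash A∈ϑ   = clash A∈ϑ ¬A∈ϑ
  ... | _ , ¬x≈x∈ϑ , irreflexive = irreflexive ¬x≈x∈ϑ

  to : ClosedBranch ϑ → Any (Clashes ϑ) ϑ
  to (clash A∈ϑ ¬A∈ϑ)    = lose ¬A∈ϑ (clash A∈ϑ)
  to (irreflexive ¬x≈x∈ϑ) = lose ¬x≈x∈ϑ irreflexive

-- Growth of branches during expansion

module _ {φ : CNF} {ψ : Universal} where

  Process-⊇ : ∀ {τ ϑ ϑ′ new} → Process φ ψ τ ϑ ϑ′ new → ϑ ⊆ ϑ′ × All (ϑ ⊆_) new
  Process-⊇ (keep _)                                      = ⊆-refl , []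
  Process-⊇ (apply-Eγ _ _ (eγ _ _ _))                     = there , []
  Process-⊇ (apply-PB _ _ _ _ pb (inj₁ (refl , refl)))    = there , there ∷ []
  Process-⊇ (apply-PB _ _ _ _ pb (inj₂ (refl , refl)))    = there , there ∷ []

  ForEach-⊇ : ∀ {τs ϑ ϑ′ new} → ForEach φ ψ τs ϑ ϑ′ new → ϑ ⊆ ϑ′ × All (ϑ ⊆_) new
  ForEach-⊇ []       = ⊆-refl , []
  ForEach-⊇ (p ∷ ps) =
    let ϑ⊆ϑ′ , ϑ⊆new = Process-⊇ p ; ϑ′⊆ϑ″ , ϑ′⊆new′ = ForEach-⊇ ps
    in ⊆-trans ϑ⊆ϑ′ ϑ′⊆ϑ″ , All.++⁺ ϑ⊆new (All.map (⊆-trans ϑ⊆ϑ′) ϑ′⊆new′)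

-- Both rules only append formulae, and branches split off inherit those of their parent. With `Γ`
-- the input formula, every expanded branch still contains all its conjuncts.
Expand-⊇ : ∀ {φ Γ 𝒯 𝒯′} → Expand φ 𝒯 𝒯′ → All (Γ ⊆_) 𝒯 → All (Γ ⊆_) 𝒯′
Expand-⊇ (expand {𝒯₁ = 𝒯₁} _ _ _ _ _ _ run) Γ⊆𝒯
  with Γ⊆𝒯₁ , Γ⊆ϑ ∷ Γ⊆𝒯₂ ← All.++⁻ 𝒯₁ Γ⊆𝒯 =
  let ϑ⊆ϑ′ , ϑ⊆new = ForEach-⊇ run
  in All.++⁺ Γ⊆𝒯₁ (⊆-trans Γ⊆ϑ ϑ⊆ϑ′ ∷ All.++⁺ (All.map (⊆-trans Γ⊆ϑ) ϑ⊆new) Γ⊆𝒯₂)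

Expand⋆-⊇ : ∀ {φ Γ 𝒯 𝒯′} → Star (Expand φ) 𝒯 𝒯′ → All (Γ ⊆_) 𝒯 → All (Γ ⊆_) 𝒯′
Expand⋆-⊇ ε        = id
Expand⋆-⊇ (e ◅ es) = Expand⋆-⊇ es ∘ Expand-⊇ e

-- The unifying substitution

module _ {x y z : Var₀} where

  ⨾↦-cases : ∀ w → ((w ≡ x ⊎ w ≡ y) × (x ⨾ y ↦ z) w ≡ z) ⊎ (x ⨾ y ↦ z) w ≡ w
  -- `does (w ≟ x)` computes to `w ≡ᵇ x`, so the case split is on the Boolean tests, each abstracted
  -- together with its soundness proof.
  ⨾↦-cases w with w ≡ᵇ x | ≡ᵇ⇒≡ w x | w ≡ᵇ y | ≡ᵇ⇒≡ w y
  ... | true  | w≡x | _     | _   = inj₁ (inj₁ (w≡x tt) , refl)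
  ... | false | _   | true  | w≡y = inj₁ (inj₂ (w≡y tt) , refl)
  ... | false | _   | false | _   = inj₂ refl

  ⨾↦-fixes : (x ⨾ y ↦ z) z ≡ z
  ⨾↦-fixes = [ proj₂ , id ]′ (⨾↦-cases z)

Idempotent : Subst → Set
Idempotent σ = ∀ w → σ (σ w) ≡ σ w

-- Either `σ w` is sent to `z`, which both substitutions fix, or it stays put and idempotence of `σ`
-- applies.
·-idempotent : ∀ {σ x y z} → Idempotent σ → σ z ≡ z → Idempotent (σ · (x ⨾ y ↦ z))
·-idempotent {σ} {x} {y} {z} idem σz≡z w with ⨾↦-cases {x} {y} {z} (σ w)
... | inj₁ (_ , ρσw≡z) rewrite ρσw≡z | σz≡z  = ⨾↦-fixes {x} {y} {z}
... | inj₂ ρσw≡σw rewrite ρσw≡σw | idem w     = ρσw≡σw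

module _ (_≼_ : Rel Var₀ 0ℓ) where

  -- Each step applies the whole accumulated σ_ϑ, not just {x/z, y/z}, to Eq_ϑ;
  -- this is harmless because σ_ϑ stays idempotent and fixes Eq_ϑ.
  Unify-unifies : ∀ {σ Eq σ′} → Unify _≼_ σ Eq σ′ → Idempotent σ →
    (∀ {x y} → (x , y) ∈ Eq → σ x ≡ x × σ y ≡ y) →
    (∀ w → σ′ (σ w) ≡ σ′ w) × (∀ {x y} → (x , y) ∈ Eq → σ′ x ≡ σ′ y)
  Unify-unifies {σ} (done trivial) idem _ = idem , λ p → cong σ (trivial p)
  Unify-unifies {σ} {Eq} {σ′} (step {x = x} {y} {z} xy∈Eq _ isMin rest) idem fixed =
    factors , unifies
    where
    σ₁ : Subst
    σ₁ = σ · (x ⨾ y ↦ z)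

    -- The minimum `z` is one of `x` and `y`, both fixed by `σ` as members of `Eq`.
    σz≡z : σ z ≡ z
    σz≡z = [ (λ { (z≡x , _) → fix z≡x (proj₁ (fixed xy∈Eq)) })
           , (λ { (z≡y , _) → fix z≡y (proj₂ (fixed xy∈Eq)) }) ]′ isMin
      where
      fix : ∀ {v} → z ≡ v → σ v ≡ v → σ z ≡ z
      fix refl σv≡v = σv≡v

    idem₁ : Idempotent σ₁
    idem₁ = ·-idempotent idem σz≡z

    fixed₁ : ∀ {v w} → (v , w) ∈ map (λ (v , w) → σ₁ v , σ₁ w) Eq → σ₁ v ≡ v × σ₁ w ≡ w
    fixed₁ p with (v , w) , _ , refl ← ∈-map⁻ _ p = idem₁ v , idem₁ w

    ih = Unify-unifies rest idem₁ fixed₁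

    factors : ∀ w → σ′ (σ w) ≡ σ′ w
    -- By induction `σ′` absorbs `σ₁`, and `σ₁` absorbs `σ` because `σ` is idempotent.
    factors w = trans (sym (proj₁ ih (σ w)))
      (trans (cong (σ′ ∘ (x ⨾ y ↦ z)) (idem w)) (proj₁ ih w))

    unifies : ∀ {v w} → (v , w) ∈ Eq → σ′ v ≡ σ′ w
    unifies {v} {w} p =
      trans (sym (proj₁ ih v)) (trans (proj₂ ih (∈-map⁺ _ p)) (proj₁ ih w))

-- Equations, free variables and composed renamings

equations⁺ : ∀ {ϑ x y} → lit (pos (x ≈ y)) ∈ ϑ → (x , y) ∈ equations ϑ
equations⁺ p = ∈-concatMap⁺ _ (lose p (here refl))

literalVars-free : ∀ ψ i {x} → inj₂ x ∈ literalVars (lookup (Universal.β ψ) i) →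
  x ∈ freeVars (univ ψ)
literalVars-free ψ i p =
  ∈-concatMap⁺ _ (lose (∈-toList⁺ (∈-lookup i (Universal.β ψ))) (∈-concatMap⁺ _ (lose p (here refl))))

mapAtom-∘ : ∀ {V W Z : Set} (g : W → Z) (f : V → W) A →
  mapAtom g (mapAtom f A) ≡ mapAtom (g ∘ f) A
mapAtom-∘ g f (x ≈ y)         = refl
mapAtom-∘ g f (x ∈¹ X)        = refl
mapAtom-∘ g f (⟨ x , y ⟩∈³ X) = refl

mapLiteral-∘ : ∀ {V W Z : Set} (g : W → Z) (f : V → W) L →
  mapLiteral g (mapLiteral f L) ≡ mapLiteral (g ∘ f) L
mapLiteral-∘ g f (pos A) = cong pos (mapAtom-∘ g f A)
mapLiteral-∘ g f (neg A) = cong neg (mapAtom-∘ g f A)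

-- Injectivity of Kuratowski pairs up to extensional equality

module _ {D : Set} where

  private
    infix 4 _≃₁_ _≃₂_
    _≃₁_ = Setoid._≈_ (𝒫¹ D)
    _≃₂_ = Setoid._≈_ (𝒫² D)

    ⟅_,_⟆ : D → D → 𝒫 (setoid D)
    ⟅_,_⟆ = ｛_,_｝ {S = setoid D}

  singleton-≃ : ∀ {u v w} → ⟅ u , u ⟆ ≃₁ ⟅ v , w ⟆ → u ≡ v × u ≡ w
  singleton-≃ (_ , ⊇) = sym (reduce (⊇ (inj₁ refl))) , sym (reduce (⊇ (inj₂ refl)))

  doubleton-≃ : ∀ {u v w} → ⟅ u , v ⟆ ≃₁ ⟅ u , w ⟆ → v ≡ w
  doubleton-≃ (⊆ , ⊇) with ⊆ (inj₂ refl) | ⊇ (inj₂ refl)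
  ... | inj₂ v≡w  | _         = v≡w
  ... | inj₁ v≡u  | inj₁ w≡u  = trans v≡u (sym w≡u)
  ... | inj₁ _    | inj₂ w≡v  = sym w≡v

  pair-injective : ∀ {u v u′ v′ : D} → pair u v ≃₂ pair u′ v′ → u ≡ u′ × v ≡ v′
  pair-injective {u} {v} {u′} {v′} (⊆ , ⊇) with u≡u′
    where
    u≡u′ : u ≡ u′
    u≡u′ = [ proj₁ ∘ singleton-≃ , proj₁ ∘ singleton-≃ ]′
             (⊆ {⟅ u , u ⟆} (inj₁ (Setoid.refl (𝒫¹ D) {⟅ u , u ⟆})))
  -- With first components identified, `{u, v}` and `{u, v′}` are each located in the other pair. If
  -- both collapse to `{u}`, then `v` and `v′` equal `u`.
  ... | refl with ⊆ {⟅ u , v ⟆} (inj₂ (Setoid.refl (𝒫¹ D) {⟅ u , v ⟆}))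
                | ⊇ {⟅ u , v′ ⟆} (inj₂ (Setoid.refl (𝒫¹ D) {⟅ u , v′ ⟆}))
  ... | inj₂ uv≃uv′ | _           = refl , doubleton-≃ uv≃uv′
  ... | inj₁ _      | inj₂ uv′≃uv = refl , sym (doubleton-≃ uv′≃uv)
  ... | inj₁ uv≃uu  | inj₁ uv′≃uu = refl , trans (doubleton-≃ uv≃uu) (sym (doubleton-≃ uv′≃uu))

-- The Herbrand-style model and its truth lemma

module Model (names : List Var₀) (default : ∃ (_∈ names)) (ϑ : Branch) where

  _∈ⁿ?_ = member? _≟_

  -- The truth value of a decision, rather than a membership proof, keeps elements
  -- with the same name propositionally equal.
  Domain : Set
  Domain = Σ Var₀ λ v → True (v ∈ⁿ? names)

  Domain-≡ : {d e : Domain} → proj₁ d ≡ proj₁ e → d ≡ e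
  Domain-≡ {_ , p} {_ , q} refl = cong (_ ,_) (T-irrelevant p q)

  -- Variables outside `names` get the default value. This cannot affect `φ`, since `names` will
  -- contain `σ x` for each `x` in `Vars₀ φ`.
  element : Var₀ → Domain
  element v with v ∈ⁿ? names
  ... | yes v∈ = v , fromWitness v∈
  ... | no _   = proj₁ default , fromWitness (proj₂ default)

  element-name : ∀ {v} → v ∈ names → proj₁ (element v) ≡ v
  element-name {v} v∈ with v ∈ⁿ? names
  ... | yes _  = refl
  ... | no v∉  = contradiction v∈ v∉

  model : Subst → Interpretation
  model σ = record
    { D        = Domain
    ; nonempty = element (proj₁ default)
    ; M₀       = element ∘ σ
    ; M₁       = λ X → record
      { member = λ d → lit (pos (proj₁ d ∈¹ X)) ∈ ϑ
      ; resp   = λ { refl → id } }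
    -- The pairs listed on the branch are closed under extensional equality, as `resp` demands.
    ; M₃       = λ X → record
      { member = λ p → ∃₂ λ (d e : Domain) →
                   lit (pos (⟨ proj₁ d , proj₁ e ⟩∈³ X)) ∈ ϑ × Setoid._≈_ (𝒫² Domain) p (pair d e)
      ; resp   = λ { p≃q (d , e , de∈X , p≃de) →
                   d , e , de∈X , Unary.≐-trans (Unary.≐-sym p≃q) p≃de } } }

  module Truth (isOpen : OpenBranch ϑ)
               (equal : ∀ {x y} → lit (pos (x ≈ y)) ∈ ϑ → x ≡ y)
               (σ : Subst) {V : Set} (η : V → Domain) (f : V → Var₀) where

    -- Positive memberships hold by construction and equations by `equal`. If the atom of a negative
    -- literal were true, the branch would contain that atom or the literal would have the form
    -- `¬ (x ≈ x)`; either closes the branch.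
    truth : ∀ L → (∀ {v} → v ∈ literalVars L → proj₁ (η v) ≡ f v) →
            lit (mapLiteral f L) ∈ ϑ → ⟦ model σ ⟧ˡ L η
    truth (pos (x ≈ y)) η≡f p =
      lift (Domain-≡ (trans (η≡f (here refl)) (trans (equal p) (sym (η≡f (there (here refl)))))))
    truth (pos (x ∈¹ X)) η≡f p rewrite sym (η≡f (here refl)) = lift p
    truth (pos (⟨ x , y ⟩∈³ X)) η≡f p
      rewrite sym (η≡f (here refl)) | sym (η≡f (there (here refl))) =
      η x , η y , p , Unary.≐-refl
    truth (neg (x ≈ y)) η≡f p (lift ηx≡ηy)
      rewrite sym (η≡f (here refl)) | sym (η≡f (there (here refl))) | ηx≡ηy =
      isOpen (irreflexive p)
    truth (neg (x ∈¹ X)) η≡f p (lift q) rewrite sym (η≡f (here refl)) = isOpen (clash q p)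
    truth (neg (⟨ x , y ⟩∈³ X)) η≡f p (d , e , q , xy≃de)
      rewrite sym (η≡f (here refl)) | sym (η≡f (there (here refl)))
      -- The model only says that the pair is extensionally equal to a listed one; injectivity
      -- recovers the literal on the branch.
      with refl , refl ← pair-injective xy≃de = isOpen (clash q p)

-- Satisfying the conjuncts from a fulfilled branch

module _ {φ : CNF} (default : ∃ (_∈ Vars₀ φ)) {ϑ : Branch} {σ : Subst}
         (φ⊆ϑ : φ ⊆ ϑ) (fulfilled : FulfilledBranch φ ϑ)
         (unifies : ∀ {x y} → lit (pos (x ≈ y)) ∈ ϑ → σ x ≡ σ y)
         (isOpen : OpenBranch (map (_⟪ σ ⟫) ϑ)) where

  private
    ϑσ    = map (_⟪ σ ⟫) ϑ
    names = map σ (Vars₀ φ)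

  open Model names (σ (proj₁ default) , ∈-map⁺ σ (proj₂ default)) ϑσ

  equalσ : ∀ {x y} → lit (pos (x ≈ y)) ∈ ϑσ → x ≡ y
  equalσ p with ∈-map⁻ (_⟪ σ ⟫) p
  ... | lit (pos (_ ≈ _)) , q , refl = unifies q

  open Truth isOpen equalσ σ

  -- Turns a semantic assignment of the quantified variables into an instantiation over `Vars₀ φ`,
  -- the only kind that fulfilledness speaks about.
  preimage : ∀ {k} (u : Vec Domain k) →
    ∃ λ τ → VecAll.All (_∈ Vars₀ φ) τ × (∀ i → proj₁ (lookup u i) ≡ σ (lookup τ i))
  preimage Vec.[] = Vec.[] , VecAll.[] , λ ()
  preimage ((v , v∈) Vec.∷ u)
    with x , x∈ , refl ← ∈-map⁻ σ (toWitness v∈) | τ , τ∈ , u≡στ ← preimage u =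
    x Vec.∷ τ , x∈ VecAll.∷ τ∈ , λ { zero → refl ; (suc i) → u≡στ i }

  element-σ : ∀ {F x} → F ∈ φ → x ∈ freeVars F → proj₁ (element (σ x)) ≡ σ x
  element-σ F∈φ x∈F = element-name (∈-map⁺ σ (∈-concatMap⁺ _ (lose F∈φ x∈F)))

  conjunct : ∀ F → F ∈ φ → (⊨ model σ) F
  conjunct (lit L)  L∈φ =
    truth (element ∘ σ) σ L (element-σ L∈φ) (∈-map⁺ (_⟪ σ ⟫) (φ⊆ϑ L∈φ))
  conjunct (univ ψ) ψ∈φ u
    with τ , τ∈ , u≡στ ← preimage u
    with i , βᵢτ∈ϑ ← fulfilled ψ (φ⊆ϑ ψ∈φ) τ τ∈ =
    i , truth [ lookup u , element ∘ σ ]′ (σ ∘ [ lookup τ , id ]′) βᵢ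
          (λ { {inj₁ k} _ → u≡στ k
             ; {inj₂ x} x∈ → element-σ ψ∈φ (literalVars-free ψ i x∈) })
          -- Instantiating by `τ` and then applying `σ` is fused into one renaming, the form `truth`
          -- expects.
          (subst (λ L → lit L ∈ ϑσ) (mapLiteral-∘ σ _ βᵢ) (∈-map⁺ (_⟪ σ ⟫) βᵢτ∈ϑ))
    where βᵢ = lookup (Universal.β ψ) i

  fulfilledBranch⇒satisfiable : Satisfiable φ
  fulfilledBranch⇒satisfiable = model σ , All.tabulate (conjunct _)

-- Finding an open branch in the final tableau

module _ (_≼_ : Rel Var₀ 0ℓ) {φ : CNF} (default : ∃ (_∈ Vars₀ φ)) where

  unified⇒satisfiable : ∀ {𝒯 𝒯′ ℰ} → UnifyBranches _≼_ 𝒯 𝒯′ ℰ → All (φ ⊆_) 𝒯 →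
    FulfilledTableau φ 𝒯 → ¬ Closed 𝒯′ → Satisfiable φ
  unified⇒satisfiable [] _ _ ¬closed = ⊥-elim (¬closed [])
  unified⇒satisfiable (closed c rest) (_ ∷ φ⊆𝒯) (_ ∷ fs) ¬closed =
    unified⇒satisfiable rest φ⊆𝒯 fs (¬closed ∘ (c ∷_))
  unified⇒satisfiable (open′ isOpen _ _) _ (inj₂ c ∷ _) _ = contradiction c isOpen
  unified⇒satisfiable (open′ {ϑ} {σ} _ unify rest) (φ⊆ϑ ∷ φ⊆𝒯) (inj₁ f ∷ fs) ¬closed
    -- A branch open before unification may close once `σ` is applied, so closure is decided again;
    -- a closed one is skipped.
    with closedBranch? (map (_⟪ σ ⟫) ϑ)
  ... | yes c = unified⇒satisfiable rest φ⊆𝒯 fs (¬closed ∘ (c ∷_))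
  ... | no ¬c = fulfilledBranch⇒satisfiable default φ⊆ϑ f (unifies ∘ equations⁺) ¬c
    where unifies = proj₂ (Unify-unifies _≼_ unify (λ _ → refl) (λ _ → refl , refl))

Vars₀-++⁺ʳ : ∀ φ {φ′ x} → x ∈ Vars₀ φ′ → x ∈ Vars₀ (φ ++ φ′)
Vars₀-++⁺ʳ φ {φ′} p with F , F∈φ′ , x∈F ← find (∈-concatMap⁻ freeVars {φ′} p) =
  ∈-concatMap⁺ freeVars (lose (∈-++⁺ʳ φ F∈φ′) x∈F)

theorem2 : (𝐃 : DataTypeMap) (𝒯𝓇 : Translation 𝐃) (𝒦ℬ : KnowledgeBase 𝐃) →
    (_≼_ : Rel Var₀ 0ℓ) → IsTotalOrder _≡_ _≼_ →
    (𝒯 : Tableau) (ℰ : List (Branch × Subst)) →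
    Consistency _≼_ (Translation.φ 𝒯𝓇 𝒦ℬ) 𝒯 ℰ →
    ¬ Closed 𝒯 →
    Satisfiable (Translation.φ 𝒯𝓇 𝒦ℬ)
theorem2 𝐃 𝒯𝓇 𝒦ℬ _≼_ _ 𝒯 ℰ run ¬closed =
  unified⇒satisfiable _≼_ default unify (Expand⋆-⊇ expansion (id ∷ [])) fulfilled ¬closed
  where
  open Consistency run
  open Translation 𝒯𝓇
  -- The Herbrand domain is nonempty only if `φ` has a variable of sort 0; the constraints supply
  -- one.
  default = let x , x∈ = domains-named 𝒦ℬ
            in x , Vars₀-++⁺ʳ (concatMap θ (KnowledgeBase.statements 𝒦ℬ)) x∈
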